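{- If $G$ is a block graph, then the $2$-independence complex $\mathrm{Ind}_2(G)$ is shellable.
   Context: All graphs are finite and simple. A block of a graph is a maximal connected subgraph that remains connected after removal of any single vertex; $G$ is a block graph if every block of $G$ is a complete graph. For a graph $G$ and integer $r \geq 1$, a subset $A \subseteq V(G)$ is $r$-independent if every connected component of the induced subgraph $G[A]$ has at most $r$ vertices; $\mathrm{Ind}_r(G)$ is the simplicial complex on $V(G)$ whose faces are the $r$-independent subsets. A (not necessarily pure) simplicial complex is shellable if its facets can be ordered $F_1, \dots, F_t$ so that for each $k>1$, $\langle F_k\rangle \cap \langle F_1,\dots,F_{k-1}\rangle$ is pure of dimension $\dim F_k - 1$ ($\langle \mathcal F\rangle$ = complex generated by $\mathcal F$). -}

module Defs where

open import Data.Bool using (Bool; true; false)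
open import Data.Nat using (ℕ; _+_; _≤_; _<_)
open import Data.Fin using (Fin; toℕ)
open import Data.Fin.Subset using (Subset; _∈_; _⊆_; _-_; ∣_∣; Nonempty)
open import Data.Product using (Σ; ∃; _×_)
open import Relation.Binary.PropositionalEquality using (_≡_; _≢_)
open import Function.Definitions using (Injective)

record Graph (n : ℕ) : Set where
  field
    adj   : Fin n → Fin n → Bool
    sym   : ∀ u v → adj u v ≡ adj v u
    irrefl : ∀ v → adj v v ≡ false

module _ {n : ℕ} (G : Graph n) where
  open Graph G

  Adj : Fin n → Fin n → Set
  Adj u v = adj u v ≡ true

  data Walk (A : Subset n) : Fin n → Fin n → Set where
    here : ∀ {u} → u ∈ A → Walk A u u
    step : ∀ {u w v} → u ∈ A → Adj u w → Walk A w v → Walk A u v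

  -- G[A] is connected (the empty graph counts as connected)
  Connected : Subset n → Set
  Connected A = ∀ u v → u ∈ A → v ∈ A → Walk A u v

  NonSeparable : Subset n → Set
  NonSeparable B = Nonempty B × Connected B × (∀ v → v ∈ B → Connected (B - v))

  -- a block: maximal (w.r.t. inclusion) such vertex set (blocks are induced)
  IsBlock : Subset n → Set
  IsBlock B = NonSeparable B × (∀ C → NonSeparable C → B ⊆ C → C ≡ B)

  IsClique : Subset n → Set
  IsClique B = ∀ u v → u ∈ B → v ∈ B → u ≢ v → Adj u v

  BlockGraph : Set
  BlockGraph = ∀ B → IsBlock B → IsClique B

  -- A is r-independent: every connected component of G[A] has at most r
  -- vertices (the component of v is the set of vertices reachable from v in G[A])
  RIndependent : ℕ → Subset n → Set
  RIndependent r A = ∀ v → v ∈ A → ∀ (S : Subset n) →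
    (∀ w → w ∈ S → Walk A v w) → ∣ S ∣ ≤ r

Complex : ℕ → Set₁
Complex n = Subset n → Set

Ind : ∀ {n} → Graph n → ℕ → Complex n
Ind G r = RIndependent G r

IsFacet : ∀ {n} → Complex n → Subset n → Set
IsFacet Δ σ = Δ σ × (∀ τ → Δ τ → σ ⊆ τ → τ ≡ σ)

-- Shellability (not necessarily pure): an ordering F 0, …, F (t-1) of all the
-- facets such that for each k > 0 (k ≥ 2 in 1-based indexing),
-- ⟨F k⟩ ∩ ⟨F 0, …, F (k-1)⟩ is pure of dimension dim F k - 1,
-- i.e. all its facets σ satisfy ∣σ∣ + 1 = ∣F k∣.
Shellable : ∀ {n} → Complex n → Set
Shellable {n} Δ = Σ ℕ λ t → Σ (Fin t → Subset n) λ F →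
  (∀ i → IsFacet Δ (F i)) ×
  (∀ σ → IsFacet Δ σ → ∃ λ i → F i ≡ σ) ×
  Injective _≡_ _≡_ F ×
  (∀ k → 0 < toℕ k →
     ∀ σ → IsFacet (λ τ → τ ⊆ F k × ∃ λ j → toℕ j < toℕ k × τ ⊆ F j) σ →
       ∣ σ ∣ + 1 ≡ ∣ F k ∣)

{-# OPTIONS --safe #-}
module Submission where

-- Woodroofe's argument for chordal clutters, applied to the minors of Ind₂(G). The
-- minor between L ⊆ U consists of the faces T with L ⊆ T ⊆ U. If v is a simplicial
-- vertex of it, list first the facets through v, a shelling of [L ∪ {v}, U], and
-- then, for each S such that S ∪ {v} is a minimal nonface, the facets that contain S
-- but not v, a shelling of [S, U ─ {v}]. A facet X in the group of S and an earlier
-- one Y outside it satisfy S ⊈ Y; for x ∈ S ─ Y the set (X ─ {x}) ∪ {v} is a face,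
-- hence lies in a facet through v, which is earlier than X.
--
-- If L ∪ {v} is not a face for some v ∈ U ─ L, that v is simplicial. Otherwise take an
-- end block B of the graph induced on U ─ L and those vertices of L whose neighbourhood
-- in U ─ L is not a clique. If a noncut vertex v of B has no neighbour in L outside this
-- graph, its neighbourhood in U is a clique and v is simplicial. If every noncut vertex
-- of B has such a neighbour, no face containing L has two vertices in B ─ L, and this
-- makes each noncut vertex of B simplicial.

open import Defs
open import Data.Bool using (true; false)
import Data.Bool.Properties as Bool
open import Data.Empty using (⊥; ⊥-elim)
open import Data.Fin using (Fin; zero; suc; toℕ; _≟_)
open import Data.Fin.Properties using (any?; all?; toℕ-injective)
open import Data.Fin.Subset using (Subset; Nonempty; _∈_; _∉_; _⊆_; _⊂_; _⊃_; _∪_; _─_; _-_; ⁅_⁆; ∣_∣)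
import Data.Fin.Subset as Subset
open import Data.Fin.Subset.Properties
open import Data.Fin.Subset.Induction using (⊂-wellFounded; ⊃-wellFounded; Acc; acc)
open import Data.List using (List; []; _∷_; _++_; map; concatMap; deduplicate; length; lookup)
import Data.List.Membership.Propositional as List
open import Data.List.Membership.Propositional.Properties
  using (∈-++⁺ˡ; ∈-++⁺ʳ; ∈-++⁻; ∈-map⁺; ∈-concatMap⁺; ∈-concatMap⁻; ∈-deduplicate⁺; ∈-lookup)
open import Data.List.Relation.Unary.Any using (here; there)
import Data.List.Relation.Unary.Any as Any
open import Data.List.Relation.Unary.Any.Properties using (lookup-index)
import Data.List.Relation.Unary.All as All
open import Data.List.Relation.Unary.AllPairs using ([]; _∷_)
open import Data.List.Relation.Unary.Unique.Propositional using (Unique)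
import Data.List.Relation.Unary.Unique.DecPropositional.Properties as Unique
open import Data.Nat using (ℕ; suc; _+_; _≤_; _<_; z≤n; s≤s)
open import Data.Nat.Properties using (≤-trans; ≤-reflexive; m≤n⇒m≤1+n; <-cmp; +-comm; <-irrefl; ≤-antisym)
open import Data.Product using (∃; _×_; _,_; proj₁; proj₂)
open import Data.Sum using (_⊎_; inj₁; inj₂; [_,_]′)
import Data.Sum as Sum
open import Data.Unit using (⊤; tt)
open import Data.Vec using ([]; _∷_; here; there; tabulate)
import Data.Vec.Properties as Vec
open import Function using (_∘_)
open import Relation.Binary using (DecidableEquality; tri<; tri≈; tri>)
open import Relation.Binary.PropositionalEquality using (_≡_; _≢_; refl; sym; trans; cong; subst)
open import Relation.Nullary using (¬_; Dec; yes; no; does; contradiction)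
open import Relation.Nullary.Decidable using (_×-dec_; _⊎-dec_; dec-true; _→-dec_; ¬?; decidable-stable)
open import Relation.Unary using (Decidable)

-- Finite sets of vertices.

private
  variable
    n : ℕ
    x y : Fin n
    p q r s : Subset n

infixl 6 _⊕_

_⊕_ : Subset n → Fin n → Subset n
p ⊕ x = p ∪ ⁅ x ⁆

p⊆p⊕x : p ⊆ p ⊕ x
p⊆p⊕x {x = x} = p⊆p∪q ⁅ x ⁆

x∈p⊕x : x ∈ p ⊕ x
x∈p⊕x {x = x} {p = p} = q⊆p∪q p ⁅ x ⁆ (x∈⁅x⁆ x)

x∈p⊕y⁻ : x ∈ p ⊕ y → x ∈ p ⊎ x ≡ y
x∈p⊕y⁻ {p = p} {y = y} = Sum.map₂ (x∈⁅y⁆⇒x≡y y) ∘ x∈p∪q⁻ p ⁅ y ⁆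

⊕-least : p ⊆ q → x ∈ q → p ⊕ x ⊆ q
⊕-least p⊆q x∈q = [ p⊆q , (λ { refl → x∈q }) ]′ ∘ x∈p⊕y⁻

⊕-mono : p ⊆ q → p ⊕ x ⊆ q ⊕ x
⊕-mono p⊆q = ⊕-least (p⊆p⊕x ∘ p⊆q) x∈p⊕x

x∈p─q⇒x∉q : (p q : Subset n) → x ∈ p ─ q → x ∉ q
x∈p─q⇒x∉q (_ ∷ _) (true ∷ _)  ()        here
x∈p─q⇒x∉q (_ ∷ p) (_ ∷ q)     (there m) (there m′) = x∈p─q⇒x∉q p q m m′

x∈p-y⁻ : (p : Subset n) (y : Fin n) → x ∈ p - y → x ∈ p × x ≢ y
x∈p-y⁻ p y m = p─q⊆p p ⁅ y ⁆ m , x∉⁅y⁆⇒x≢y (x∈p─q⇒x∉q p ⁅ y ⁆ m)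

⊆-minus : p ⊆ q → x ∉ p → p ⊆ q - x
⊆-minus p⊆q x∉p m = x∈p∧x≢y⇒x∈p-y (p⊆q m) (λ { refl → x∉p m })

-- Decrease of measures such as `U ─ L`. The last premise covers both ways for `x` to leave the
-- difference: `U` loses it or `L` gains it.
─-⊂ : p ⊆ q → r ⊆ s → x ∈ q → x ∉ r → (x ∈ p → x ∈ s) → p ─ s ⊂ q ─ r
─-⊂ {p = p} {s = s} p⊆q r⊆s x∈q x∉r h =
  (λ m → x∈p∧x∉q⇒x∈p─q (p⊆q (p─q⊆p p s m)) (x∈p─q⇒x∉q p s m ∘ r⊆s)) ,
  _ , x∈p∧x∉q⇒x∈p─q x∈q x∉r , λ m → x∈p─q⇒x∉q p s m (h (p─q⊆p p s m))

⊆-or-witness : (p q : Subset n) → p ⊆ q ⊎ ∃ λ x → x ∈ p × x ∉ q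
⊆-or-witness p q with any? (λ x → x ∈? p ×-dec ¬? (x ∈? q))
... | yes w = inj₂ w
... | no ¬w = inj₁ λ {x} m → decidable-stable (x ∈? q) λ m′ → ¬w (x , m , m′)

_≟ₛ_ : DecidableEquality (Subset n)
_≟ₛ_ = Vec.≡-dec Bool._≟_

allSubsets : ∀ n → List (Subset n)
allSubsets ℕ.zero    = [] ∷ []
allSubsets (ℕ.suc n) = map (true ∷_) (allSubsets n) ++ map (false ∷_) (allSubsets n)

∈-allSubsets : (p : Subset n) → p List.∈ allSubsets n
∈-allSubsets []          = here refl
∈-allSubsets (true  ∷ p) = ∈-++⁺ˡ (∈-map⁺ (true ∷_) (∈-allSubsets p))
∈-allSubsets (false ∷ p) = ∈-++⁺ʳ _ (∈-map⁺ (false ∷_) (∈-allSubsets p))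

-- Shellings as lists.

Family : ℕ → Set₁
Family n = Subset n → Set

-- The exchange form of the shelling condition: `X ∩ Y` lies in the codimension-one face `X - x`,
-- which lies in an earlier term `Z`, possibly different from `Y`.
Drop : Family n → Subset n → Subset n → Set
Drop P X Y = ∃ λ x → x ∈ X × x ∉ Y × ∃ λ Z → P Z × X - x ⊆ Z

Step : Family n → Subset n → Set
Step P X = ∀ {Y} → P Y → Drop P X Y

-- The list can be appended to a shelling whose set of terms is P.
Shelling : Family n → List (Subset n) → Set
Shelling P []       = ⊤
Shelling P (X ∷ Xs) = Step P X × Shelling (λ Y → P Y ⊎ Y ≡ X) Xs

private
  variable
    P Q : Family n
    Xs Ys : List (Subset n)
    X Y : Subset n

Drop-mono : (∀ {Z} → P Z → Q Z) → Drop P X Y → Drop Q X Y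
Drop-mono f (x , x∈X , x∉Y , Z , PZ , X-x⊆Z) = x , x∈X , x∉Y , Z , f PZ , X-x⊆Z

Shelling-cong : (∀ {Z} → P Z → Q Z) → (∀ {Z} → Q Z → P Z) → Shelling P Xs → Shelling Q Xs
Shelling-cong {Xs = []}     f g _        = tt
Shelling-cong {Xs = X ∷ Xs} f g (st , sh) =
  (λ QY → Drop-mono f (st (g QY))) , Shelling-cong (Sum.map₁ f) (Sum.map₁ g) sh

Shelling-++ : Shelling P Xs → Shelling (λ Y → P Y ⊎ Y List.∈ Xs) Ys → Shelling P (Xs ++ Ys)
Shelling-++ {Xs = []} _ sh = Shelling-cong [ (λ z → z) , (λ ()) ]′ inj₁ sh
Shelling-++ {Xs = X ∷ Xs} (st , sh) sh′ = st , Shelling-++ sh (Shelling-cong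
  (λ { (inj₁ m) → inj₁ (inj₁ m) ; (inj₂ (here e)) → inj₁ (inj₂ e) ; (inj₂ (there m)) → inj₂ m })
  (λ { (inj₁ (inj₁ m)) → inj₁ m ; (inj₁ (inj₂ e)) → inj₂ (here e) ; (inj₂ m) → inj₂ (there m) })
  sh′)

-- The witness of a drop may be any earlier term, so drops survive when more terms are put in front.
-- Only the pairs with `Y` in `P` are new.
Shelling-∪ : (∀ {X} → X List.∈ Xs → Step P X) → Shelling Q Xs → Shelling (λ Y → P Y ⊎ Q Y) Xs
Shelling-∪ {Xs = []} h _ = tt
Shelling-∪ {Xs = X ∷ Xs} {P = P} {Q = Q} h (st , sh) =
  [ Drop-mono inj₁ ∘ h (here refl) , Drop-mono inj₂ ∘ st ]′ ,
  Shelling-cong (λ { (inj₁ m) → inj₁ (inj₁ m) ; (inj₂ (inj₁ m)) → inj₁ (inj₂ m) ; (inj₂ (inj₂ m)) → inj₂ m })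
    (λ { (inj₁ (inj₁ m)) → inj₁ m ; (inj₁ (inj₂ m)) → inj₂ (inj₁ m) ; (inj₂ m) → inj₂ (inj₂ m) })
    (Shelling-∪ (h ∘ there) sh)

-- Comparisons between different groups find their witness in `P`, so the groups may follow one
-- another in any order. `Q` stands for the terms listed so far, from `P` or from groups whose index
-- is outside `is`.
Shelling-concatMap : {I : Set} (f : I → List (Subset n)) (P : Family n) →
  (∀ i → Shelling (λ _ → ⊥) (f i)) →
  (∀ {i X Y} → X List.∈ f i → P Y ⊎ (∃ λ j → j ≢ i × Y List.∈ f j) → Drop P X Y) →
  ∀ (is : List I) (Q : Family n) → Unique is → (∀ {Y} → P Y → Q Y) →
  (∀ {Y} → Q Y → P Y ⊎ ∃ λ j → (j List.∉ is) × Y List.∈ f j) →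
  Shelling Q (concatMap f is)
Shelling-concatMap f P shell drop [] Q _ _ _ = tt
Shelling-concatMap f P shell drop (i ∷ is) Q (i∉ ∷ uniq) P⊆Q Q⊆ = Shelling-++
  (Shelling-cong [ (λ z → z) , (λ ()) ]′ inj₁ (Shelling-∪ prepend (shell i)))
  (Shelling-concatMap f P shell drop is _ uniq (inj₁ ∘ P⊆Q) later)
  where
  prepend : ∀ {X} → X List.∈ f i → Step Q X
  prepend X∈ QY = Drop-mono P⊆Q (drop X∈
    (Sum.map₂ (λ { (j , j∉ , Y∈) → j , (j∉ ∘ here) , Y∈ }) (Q⊆ QY)))

  later : ∀ {Y} → Q Y ⊎ Y List.∈ f i → P Y ⊎ ∃ λ j → (j List.∉ is) × Y List.∈ f j
  later (inj₁ QY) = Sum.map₂ (λ { (j , j∉ , Y∈) → j , (j∉ ∘ there) , Y∈ }) (Q⊆ QY)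
  later (inj₂ Y∈) = inj₂ (i , (λ m → All.lookup i∉ m refl) , Y∈)

Shelled : Family n → Set
Shelled P = ∃ λ Xs → Shelling (λ _ → ⊥) Xs × (∀ {X} → X List.∈ Xs → P X) × (∀ {X} → P X → X List.∈ Xs)

-- Minors with simplicial vertices are shellable.

module _ {n : ℕ} (Face : Family n) where

  Facet : Subset n → Subset n → Family n
  Facet L U X = Face X × L ⊆ X × X ⊆ U × (∀ {x} → x ∈ U → x ∉ X → ¬ Face (X ⊕ x))

  -- In the clutter of minimal nonfaces of the minor between L and U, two edges
  -- through v have a third edge in their union minus v. Equivalently, as stated
  -- here, a face T with T ∪ {v} not a face contains exactly one minimal such set S.
  Simplicial : Subset n → Subset n → Fin n → Set
  Simplicial L U v = v ∈ U × v ∉ L ×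
    (∀ T → Face T → L ⊆ T → T ⊆ U → v ∉ T → ¬ Face (T ⊕ v) →
      ∃ λ S → L ⊆ S × S ⊆ T × ¬ Face (S ⊕ v) ×
        (∀ x → x ∈ S → x ∉ L → Face ((T - x) ⊕ v)))

module _ {n : ℕ} {Face : Family n} (Face? : Decidable Face)
         (Face-down : ∀ {X Y} → X ⊆ Y → Face Y → Face X) where

  extend-to-facet : ∀ {L U} T → Acc _⊂_ (U ─ T) → Face T → L ⊆ T → T ⊆ U →
    ∃ λ X → Facet Face L U X × T ⊆ X
  extend-to-facet {U = U} T (acc rec) fT L⊆T T⊆U
    with any? (λ x → x ∈? U ×-dec ¬? (x ∈? T) ×-dec Face? (T ⊕ x))
  ... | no ¬ext = T , (fT , L⊆T , T⊆U , λ x∈U x∉T f → ¬ext (_ , x∈U , x∉T , f)) , λ m → m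
  ... | yes (x , x∈U , x∉T , f)
    with extend-to-facet (T ⊕ x) (rec (─-⊂ (λ m → m) p⊆p⊕x x∈U x∉T (λ _ → x∈p⊕x))) f
           (p⊆p⊕x ∘ L⊆T) (⊕-least T⊆U x∈U)
  ... | X , facet , T⊕x⊆X = X , facet , T⊕x⊆X ∘ p⊆p⊕x

  module _ {L U : Subset n} {v : Fin n} (simp : Simplicial Face L U v) where

    -- S ─ L is an edge through v, with v removed, of the clutter of nonfaces over L.
    Critical : Family n
    Critical S = L ⊆ S × S ⊆ U - v × ¬ Face (S ⊕ v) × (∀ x → x ∈ S → x ∉ L → Face ((S - x) ⊕ v))

    Critical? : Decidable Critical
    Critical? S = (L ⊆? S) ×-dec (S ⊆? (U - v)) ×-dec ¬? (Face? (S ⊕ v)) ×-dec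
      all? (λ x → (x ∈? S) →-dec (¬? (x ∈? L)) →-dec Face? ((S - x) ⊕ v))

    -- If some `x` of `S₀` were outside `S`, then `S` would lie in `T - x` and `S ⊕ v` would be a
    -- face. So `S₀ ⊆ S`, and minimality of `S` forces equality.
    nonface-below⇒critical≡ : ∀ {T S S₀} → Critical S → S ⊆ T → L ⊆ S₀ → ¬ Face (S₀ ⊕ v) →
      (∀ x → x ∈ S₀ → x ∉ L → Face ((T - x) ⊕ v)) → S₀ ≡ S
    nonface-below⇒critical≡ {T} {S} {S₀} (L⊆S , S⊆ , ¬fS , minS) S⊆T L⊆S₀ ¬fS₀ min₀ =
      ⊆-antisym S₀⊆S λ {x} x∈S → decidable-stable (x ∈? S₀) λ x∉S₀ →
        ¬fS₀ (Face-down (⊕-mono (⊆-minus S₀⊆S x∉S₀)) (minS x x∈S (x∉S₀ ∘ L⊆S₀)))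
      where
      S₀⊆S : S₀ ⊆ S
      S₀⊆S {x} x∈S₀ = decidable-stable (x ∈? S) λ x∉S →
        ¬fS (Face-down (⊕-mono (⊆-minus S⊆T x∉S)) (min₀ x x∈S₀ (x∉S ∘ L⊆S)))

    v∉U-v : v ∉ U - v
    v∉U-v m = proj₂ (x∈p-y⁻ U v m) refl

    U-v⊆U : U - v ⊆ U
    U-v⊆U = p─q⊆p U ⁅ v ⁆

    critical-in-face : ∀ T → Face T → L ⊆ T → T ⊆ U - v → ¬ Face (T ⊕ v) →
      ∃ λ S → Critical S × S ⊆ T × (∀ x → x ∈ S → x ∉ L → Face ((T - x) ⊕ v))
    critical-in-face T fT L⊆T T⊆ ¬f
      with proj₂ (proj₂ simp) T fT L⊆T (U-v⊆U ∘ T⊆) (v∉U-v ∘ T⊆) ¬f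
    ... | S , L⊆S , S⊆T , ¬fS , min = S ,
      (L⊆S , T⊆ ∘ S⊆T , ¬fS , λ x x∈S x∉L → Face-down (⊕-mono
        (λ m → let y∈S , y≢x = x∈p-y⁻ S x m in x∈p∧x≢y⇒x∈p-y (S⊆T y∈S) y≢x)) (min x x∈S x∉L)) ,
      S⊆T , min

    -- The critical set that simpliciality provides below `T` can only be `S`, so its removal
    -- property is one of `S`.
    critical-removal : ∀ {S T} → Critical S → S ⊆ T → Face T → T ⊆ U - v →
      ∀ x → x ∈ S → x ∉ L → Face ((T - x) ⊕ v)
    critical-removal {S} {T} cS@(L⊆S , _ , ¬fS , _) S⊆T fT T⊆
      with critical-in-face T fT (S⊆T ∘ L⊆S) T⊆ (¬fS ∘ Face-down (⊕-mono S⊆T))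
    ... | S₀ , (L⊆S₀ , _ , ¬fS₀ , _) , _ , min₀
      with refl ← nonface-below⇒critical≡ cS S⊆T L⊆S₀ ¬fS₀ min₀ = min₀

    -- This makes the groups of facets avoiding `v` disjoint.
    critical-unique : ∀ {S S′ T} → Critical S → Critical S′ → S ⊆ T → S′ ⊆ T → Face T → T ⊆ U - v → S ≡ S′
    critical-unique cS@(L⊆S , _ , ¬fS , _) cS′ S⊆T S′⊆T fT T⊆ =
      nonface-below⇒critical≡ cS′ S′⊆T L⊆S ¬fS (critical-removal cS S⊆T fT T⊆)

    facet-through : ∀ {X} → Facet Face (L ⊕ v) U X → Facet Face L U X
    facet-through (f , L⊕v⊆ , X⊆U , max) = f , L⊕v⊆ ∘ p⊆p⊕x , X⊆U , max

    -- Maximality within `U - v` extends to `U`: adding `v` would put the nonface `S ⊕ v` into a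
    -- face.
    facet-avoiding : ∀ {S X} → Critical S → Facet Face S (U - v) X → Facet Face L U X
    facet-avoiding (L⊆S , _ , ¬fS , _) (f , S⊆X , X⊆ , max) =
      f , S⊆X ∘ L⊆S , U-v⊆U ∘ X⊆ , max′
      where
      max′ : ∀ {x} → x ∈ U → x ∉ _ → ¬ Face (_ ⊕ x)
      max′ {x} x∈U x∉X with x ≟ v
      ... | yes refl = ¬fS ∘ Face-down (⊕-mono S⊆X)
      ... | no x≢v = max (x∈p∧x≢y⇒x∈p-y x∈U x≢v) x∉X

    facet-split : ∀ {X} → Facet Face L U X →
      Facet Face (L ⊕ v) U X ⊎ ∃ λ S → Critical S × Facet Face S (U - v) X
    facet-split {X} (f , L⊆X , X⊆U , max) with v ∈? X
    ... | yes v∈X = inj₁ (f , ⊕-least L⊆X v∈X , X⊆U , max)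
    ... | no v∉X with critical-in-face X f L⊆X (⊆-minus X⊆U v∉X) (max (proj₁ simp) v∉X)
    ...   | S , cS , S⊆X , _ = inj₂ (S , cS , f , S⊆X , ⊆-minus X⊆U v∉X , max ∘ U-v⊆U)

    drop-avoiding : ∀ {S X Y} → Critical S → Facet Face S (U - v) X →
      Facet Face (L ⊕ v) U Y ⊎ (∃ λ S′ → S′ ≢ S × Critical S′ × Facet Face S′ (U - v) Y) →
      Drop (Facet Face (L ⊕ v) U) X Y
    drop-avoiding {S} {X} {Y} cS@(L⊆S , _ , ¬fS , _) (fX , S⊆X , X⊆ , _) earlier
      with ⊆-or-witness S Y
    -- Impossible: a facet `Y` through `v` would contain `S ⊕ v`, and one from another group would
    -- contain two critical sets.
    ... | inj₁ S⊆Y = ⊥-elim ([ through , avoiding ]′ earlier)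
      where
      through : ¬ Facet Face (L ⊕ v) U Y
      through (fY , L⊕v⊆Y , _) = ¬fS (Face-down (⊕-least S⊆Y (L⊕v⊆Y x∈p⊕x)) fY)

      avoiding : ¬ (∃ λ S′ → S′ ≢ S × Critical S′ × Facet Face S′ (U - v) Y)
      avoiding (S′ , S′≢S , cS′ , fY , S′⊆Y , Y⊆ , _) =
        S′≢S (critical-unique cS′ cS S′⊆Y S⊆Y fY Y⊆)
    ... | inj₂ (x , x∈S , x∉Y) =
      let Z , facetZ , ⊆Z = extend-to-facet ((X - x) ⊕ v) (⊂-wellFounded _)
            (critical-removal cS S⊆X fX X⊆ x x∈S x∉L)
            (⊕-mono (⊆-minus (S⊆X ∘ L⊆S) x∉L))
            (⊕-least (U-v⊆U ∘ X⊆ ∘ p─q⊆p X ⁅ x ⁆) (proj₁ simp))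
      in x , S⊆X x∈S , x∉Y , Z , facetZ , ⊆Z ∘ p⊆p⊕x
      where
      L⊆Y : L ⊆ Y
      L⊆Y m = [ (λ { (_ , L⊕v⊆Y , _) → L⊕v⊆Y (p⊆p⊕x m) })
              , (λ { (_ , _ , (L⊆S′ , _) , _ , S′⊆Y , _) → S′⊆Y (L⊆S′ m) }) ]′ earlier

      x∉L : x ∉ L
      x∉L = x∉Y ∘ L⊆Y

  module _ (simplicial : ∀ {L U} → Face L → L ⊆ U → (∃ λ x → x ∈ U × x ∉ L) → ∃ (Simplicial Face L U)) where

    shelled : ∀ L U → L ⊆ U → Acc _⊂_ (U ─ L) → Shelled (Facet Face L U)
    shelled L U L⊆U (acc rec) with Face? L
    ... | no ¬fL = [] , tt , (λ ()) , λ facet → ⊥-elim (¬fL (Face-down (proj₁ (proj₂ facet)) (proj₁ facet)))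
    ... | yes fL with ⊆-or-witness U L
    ...   | inj₁ U⊆L = L ∷ [] , ((λ ()) , tt) ,
      (λ { (here refl) → fL , (λ m → m) , L⊆U , λ x∈U x∉L → contradiction (U⊆L x∈U) x∉L }) ,
      λ { (_ , L⊆X , X⊆U , _) → here (⊆-antisym (U⊆L ∘ X⊆U) L⊆X) }
    ...   | inj₂ w with simplicial fL L⊆U w
    ...     | v , simp@(v∈U , v∉L , _)
      with shelled (L ⊕ v) U (⊕-least L⊆U v∈U) (rec (─-⊂ (λ m → m) p⊆p⊕x v∈U v∉L (λ _ → x∈p⊕x)))
    ...       | Xs , shXs , snd , cmp =
      Xs ++ concatMap f Ss ,
      Shelling-++ shXs (Shelling-concatMap f (List._∈ Xs) (λ S → proj₁ (proj₂ (group S)))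
        (λ {i} {X} {Y} X∈ earlier → Drop-mono cmp (drop {i} X∈ earlier))
        Ss _ (Unique.deduplicate-! _≟ₛ_ _) inj₂ [ (λ ()) , inj₁ ]′) ,
      [ facet-through simp ∘ snd , sound ]′ ∘ ∈-++⁻ Xs ,
      [ ∈-++⁺ˡ ∘ cmp , ∈-++⁺ʳ Xs ∘ complete ]′ ∘ facet-split simp
      where
      -- All subsets serve as indices, noncritical ones with an empty group. `deduplicate` supplies
      -- the `Unique` that the concatenation asks for.
      Ss : List (Subset n)
      Ss = deduplicate _≟ₛ_ (allSubsets n)

      group : ∀ S → Shelled (λ X → Critical simp S × Facet Face S (U - v) X)
      group S with Critical? simp S
      ... | no ¬c = [] , tt , (λ ()) , λ c → ⊥-elim (¬c (proj₁ c))
      ... | yes c@(L⊆S , S⊆ , _) =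
        let Ys , sh , s , k = shelled S (U - v) S⊆ (rec (─-⊂ (U-v⊆U simp) L⊆S v∈U v∉L
                                (λ m → contradiction m (v∉U-v simp))))
        in Ys , sh , (λ m → c , s m) , k ∘ proj₂

      f : Subset n → List (Subset n)
      f = proj₁ ∘ group

      f-sound : ∀ S {X} → X List.∈ f S → Critical simp S × Facet Face S (U - v) X
      f-sound S = proj₁ (proj₂ (proj₂ (group S)))

      drop : ∀ {S X Y} → X List.∈ f S → Y List.∈ Xs ⊎ (∃ λ S′ → S′ ≢ S × Y List.∈ f S′) →
        Drop (Facet Face (L ⊕ v) U) X Y
      drop {S} X∈ earlier = let c , facet = f-sound S X∈ in
        drop-avoiding simp c facet
          (Sum.map snd (λ { (S′ , ne , Y∈) → S′ , ne , f-sound S′ Y∈ }) earlier)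

      sound : ∀ {X} → X List.∈ concatMap f Ss → Facet Face L U X
      sound X∈ with S , _ , X∈fS ← List.find (∈-concatMap⁻ f {xs = Ss} X∈) =
        let c , facet = f-sound S X∈fS in facet-avoiding simp c facet

      complete : ∀ {X} → (∃ λ S → Critical simp S × Facet Face S (U - v) X) → X List.∈ concatMap f Ss
      complete (S , c , facet) = ∈-concatMap⁺ f
        (List.lose (∈-deduplicate⁺ _≟ₛ_ (∈-allSubsets S)) (proj₂ (proj₂ (proj₂ (group S))) (c , facet)))

-- From lists to indexed shellings.

lookup-step : Shelling P Xs → ∀ k →
  Step (λ Y → P Y ⊎ ∃ λ j → toℕ j < toℕ k × lookup Xs j ≡ Y) (lookup Xs k)
lookup-step {Xs = X ∷ Xs} (st , _) zero (inj₁ PY) = Drop-mono inj₁ (st PY)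
lookup-step {P = P} {Xs = X ∷ Xs} (_ , sh) (suc k) earlier = Drop-mono
  (λ { (inj₁ (inj₁ PZ)) → inj₁ PZ ; (inj₁ (inj₂ refl)) → inj₂ (zero , s≤s z≤n , refl)
     ; (inj₂ (j , j<k , e)) → inj₂ (suc j , s≤s j<k , e) })
  (lookup-step sh k (case earlier))
  where
  case : ∀ {Y} → P Y ⊎ (∃ λ j → toℕ j < toℕ (suc k) × lookup (X ∷ Xs) j ≡ Y) →
    (P Y ⊎ Y ≡ X) ⊎ ∃ λ j → toℕ j < toℕ k × lookup Xs j ≡ Y
  case (inj₁ PY) = inj₁ (inj₁ PY)
  case (inj₂ (zero , _ , refl)) = inj₁ (inj₂ refl)
  case (inj₂ (suc j , s≤s j<k , e)) = inj₂ (j , j<k , e)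

∣p∣≤1+∣p-x∣ : (p : Subset n) (x : Fin n) → ∣ p ∣ ≤ suc ∣ p - x ∣
∣p∣≤1+∣p-x∣ (true  ∷ p) zero    = s≤s (≤-reflexive (cong ∣_∣ (sym (p─⊥≡p p))))
∣p∣≤1+∣p-x∣ (false ∷ p) zero    = m≤n⇒m≤1+n (≤-reflexive (cong ∣_∣ (sym (p─⊥≡p p))))
∣p∣≤1+∣p-x∣ (true  ∷ p) (suc x) = s≤s (∣p∣≤1+∣p-x∣ p x)
∣p∣≤1+∣p-x∣ (false ∷ p) (suc x) = ∣p∣≤1+∣p-x∣ p x

3≤∣p∣ : ∀ {x y z} (p : Subset n) → x ∈ p → y ∈ p → z ∈ p → x ≢ y → y ≢ z → x ≢ z → 3 ≤ ∣ p ∣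
3≤∣p∣ {x = x} {y} {z} p x∈ y∈ z∈ x≢y y≢z x≢z =
  ≤-trans (s≤s (≤-trans (s≤s (≤-trans (s≤s z≤n) (x∈p⇒∣p-x∣<∣p∣ z∈p-x-y))) (x∈p⇒∣p-x∣<∣p∣ y∈p-x)))
    (x∈p⇒∣p-x∣<∣p∣ x∈)
  where
  y∈p-x : y ∈ p - x
  y∈p-x = x∈p∧x≢y⇒x∈p-y y∈ (x≢y ∘ sym)

  z∈p-x-y : z ∈ p - x - y
  z∈p-x-y = x∈p∧x≢y⇒x∈p-y (x∈p∧x≢y⇒x∈p-y z∈ (x≢z ∘ sym)) (y≢z ∘ sym)

shelled⇒shellable : (Δ : Complex n) → (∀ {X Y} → X ⊆ Y → Δ Y → Δ X) →
  Shelled (IsFacet Δ) → Shellable Δ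
shelled⇒shellable Δ down (Xs , sh , sound , complete) =
  length Xs , lookup Xs , (λ i → sound (∈-lookup i)) ,
  (λ σ facet → let m = complete facet in Any.index m , sym (lookup-index m)) ,
  injective , pure
  where
  later-drop : ∀ {j k} → toℕ j < toℕ k →
    ∃ λ x → x ∈ lookup Xs k × x ∉ lookup Xs j ×
    ∃ λ i → toℕ i < toℕ k × lookup Xs k - x ⊆ lookup Xs i
  later-drop {j} {k} j<k with lookup-step sh k (inj₂ (j , j<k , refl))
  ... | x , x∈ , x∉ , _ , inj₂ (i , i<k , refl) , ⊆i = x , x∈ , x∉ , i , i<k , ⊆i

  -- The dropped vertex is in the later term and not in the earlier one, so a shelling never repeats
  -- a term.
  distinct : ∀ {j k} → toℕ j < toℕ k → lookup Xs j ≢ lookup Xs k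
  distinct {j} j<k e with later-drop {j} j<k
  ... | _ , x∈ , x∉ , _ rewrite e = x∉ x∈

  injective : ∀ {j k} → lookup Xs j ≡ lookup Xs k → j ≡ k
  injective {j} {k} e with <-cmp (toℕ j) (toℕ k)
  ... | tri< lt _ _ = contradiction e (distinct lt)
  ... | tri≈ _ eq _ = toℕ-injective eq
  ... | tri> _ _ gt = contradiction (sym e) (distinct gt)

  pure : ∀ k → 0 < toℕ k → ∀ σ →
    IsFacet (λ τ → τ ⊆ lookup Xs k × ∃ λ j → toℕ j < toℕ k × τ ⊆ lookup Xs j) σ →
    ∣ σ ∣ + 1 ≡ ∣ lookup Xs k ∣
  pure k _ σ ((σ⊆k , j , j<k , σ⊆j) , max) with later-drop {j} {k} j<k
  ... | x , x∈k , x∉j , i , i<k , k-x⊆i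
    -- `σ` avoids `x` because it lies in term `j`. So it lies in the set `lookup Xs k - x`, itself a
    -- member of the intersection, and maximality makes the two equal.
    with refl ← max (lookup Xs k - x) (p─q⊆p _ _ , i , i<k , k-x⊆i) (⊆-minus σ⊆k (x∉j ∘ σ⊆j))
    = trans (+-comm _ 1) (≤-antisym (x∈p⇒∣p-x∣<∣p∣ x∈k) (∣p∣≤1+∣p-x∣ (lookup Xs k) x))

-- Decidable predicates on vertices.

⟪_⟫ : {P : Fin n → Set} → Decidable P → Subset n
⟪ P? ⟫ = tabulate (does ∘ P?)

∈⟪⟫⁺ : {P : Fin n → Set} (P? : Decidable P) → P x → x ∈ ⟪ P? ⟫
∈⟪⟫⁺ {x = x} P? Px = Vec.lookup⇒[]= x _ (trans (Vec.lookup∘tabulate _ x) (dec-true (P? x) Px))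

∈⟪⟫⁻ : {P : Fin n → Set} (P? : Decidable P) → x ∈ ⟪ P? ⟫ → P x
∈⟪⟫⁻ {x = x} P? m with P? x | trans (sym (Vec.lookup∘tabulate (does ∘ P?) x)) (Vec.[]=⇒lookup m)
... | yes Px | _  = Px
... | no _   | ()

-- Serves where `P` comes without a decision procedure: each vertex offers either walks or a
-- separation.
∀-or-∃ : {P Q : Fin n → Set} → (∀ i → P i ⊎ Q i) → (∀ i → P i) ⊎ ∃ Q
∀-or-∃ {n = ℕ.zero} h = inj₁ λ ()
∀-or-∃ {n = suc n} h with h zero | ∀-or-∃ (h ∘ suc)
... | inj₂ q | _ = inj₂ (zero , q)
... | inj₁ _ | inj₂ (i , q) = inj₂ (suc i , q)
... | inj₁ p | inj₁ ps = inj₁ λ { zero → p ; (suc i) → ps i }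

AtMostOne : Subset n → Set
AtMostOne p = ∀ {x y} → x ∈ p → y ∈ p → x ≡ y

-- Separations and end blocks.

module _ {n : ℕ} (G : Graph n) where

  open Graph G using (adj; irrefl)

  infix 4 _~_ _~?_

  _~_ : Fin n → Fin n → Set
  _~_ = Adj G

  _~?_ : ∀ u v → Dec (u ~ v)
  u ~? v = adj u v Bool.≟ true

  ~-sym : ∀ {u v} → u ~ v → v ~ u
  ~-sym {u} {v} = trans (Graph.sym G v u)

  ~⇒≢ : ∀ {u v} → u ~ v → u ≢ v
  ~⇒≢ {u} u~u refl with () ← trans (sym (irrefl u)) u~u

  _◅◅_▻_ : ∀ {A u v w} → Walk G A u v → v ~ w → w ∈ A → Walk G A u w
  here u∈A ◅◅ u~w ▻ w∈A = step u∈A u~w (here w∈A)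
  step u∈A u~x p ◅◅ v~w ▻ w∈A = step u∈A u~x (p ◅◅ v~w ▻ w∈A)

  ClosedIn : Subset n → Subset n → Set
  ClosedIn W X = ∀ {a b} → a ∈ X → b ∈ W → a ~ b → b ∈ X

  component : ∀ {W u} X → Acc _⊂_ (W ─ X) → u ∈ X → X ⊆ W → (∀ {w} → w ∈ X → Walk G W u w) →
    ∃ λ Y → u ∈ Y × Y ⊆ W × (∀ {w} → w ∈ Y → Walk G W u w) × ClosedIn W Y
  component {W} {u} X (acc rec) u∈X X⊆W walks
    with any? (λ a → any? λ b → a ∈? X ×-dec b ∈? W ×-dec ¬? (b ∈? X) ×-dec a ~? b)
  ... | no ¬exit = X , u∈X , X⊆W , walks , λ {a} {b} a∈X b∈W a~b →
    decidable-stable (b ∈? X) λ b∉X → ¬exit (a , b , a∈X , b∈W , b∉X , a~b)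
  ... | yes (a , b , a∈X , b∈W , b∉X , a~b) =
    component (X ⊕ b) (rec (─-⊂ (λ m → m) p⊆p⊕x b∈W b∉X (λ _ → x∈p⊕x))) (p⊆p⊕x u∈X)
      (⊕-least X⊆W b∈W)
      ([ walks , (λ { refl → walks a∈X ◅◅ a~b ▻ b∈W }) ]′ ∘ x∈p⊕y⁻)

  -- `X` is a nonempty proper union of components of `G[W]`.
  Separation : Subset n → Subset n → Set
  Separation W X = X ⊆ W × (∃ λ x → x ∈ X) × (∃ λ y → y ∈ W × y ∉ X) × ClosedIn W X

  Separation-sym : ∀ {W X} → Separation W X → Separation W (W ─ X)
  Separation-sym {W} {X} (X⊆W , (x , x∈X) , (y , y∈W , y∉X) , closed) =
    p─q⊆p W X , (y , x∈p∧x∉q⇒x∈p─q y∈W y∉X) , (x , X⊆W x∈X , λ m → x∈p─q⇒x∉q W X m x∈X) ,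
    λ a∈ b∈W a~b → x∈p∧x∉q⇒x∈p─q b∈W λ b∈X →
      x∈p─q⇒x∉q W X a∈ (closed b∈X (p─q⊆p W X a∈) (~-sym a~b))

  connected-or-separation : ∀ W → Connected G W ⊎ ∃ (Separation W)
  connected-or-separation W = Sum.map₂ proj₂ (∀-or-∃ from)
    where
    from : ∀ u → (∀ v → u ∈ W → v ∈ W → Walk G W u v) ⊎ ∃ (Separation W)
    from u with u ∈? W
    ... | no u∉W = inj₁ λ _ u∈W → contradiction u∈W u∉W
    ... | yes u∈W with component ⁅ u ⁆ (⊂-wellFounded _) (x∈⁅x⁆ u)
                         (λ m → subst (_∈ W) (sym (x∈⁅y⁆⇒x≡y u m)) u∈W)
                         (λ m → subst (Walk G W u) (sym (x∈⁅y⁆⇒x≡y u m)) (here u∈W))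
    ...   | Y , u∈Y , Y⊆W , walks , closed with ⊆-or-witness W Y
    ...     | inj₁ W⊆Y = inj₁ λ _ _ v∈W → walks (W⊆Y v∈W)
    ...     | inj₂ w = inj₂ (Y , Y⊆W , (u , u∈Y) , w , closed)

  -- `R` is empty if `G[B]` is disconnected and otherwise consists of a cut vertex, which gives both
  -- failures the same form.
  nonseparable-or-separation : ∀ B → Nonempty B →
    NonSeparable G B ⊎ ∃ λ R → R ⊆ B × AtMostOne R × ∃ (Separation (B ─ R))
  nonseparable-or-separation B ne
    with connected-or-separation B
  ... | inj₂ sep = inj₂ (Subset.⊥ , (λ m → contradiction m ∉⊥) , (λ m → contradiction m ∉⊥) ,
                         subst (∃ ∘ Separation) (sym (p─⊥≡p B)) sep)
  ... | inj₁ conn with ∀-or-∃ at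
    where
    at : ∀ v → (v ∈ B → Connected G (B - v)) ⊎ (v ∈ B × ∃ (Separation (B - v)))
    at v with v ∈? B
    ... | no v∉B = inj₁ λ v∈B → contradiction v∈B v∉B
    ... | yes v∈B = Sum.map (λ c _ → c) (v∈B ,_) (connected-or-separation (B - v))
  ...   | inj₁ conns = inj₁ (ne , conn , conns)
  ...   | inj₂ (v , v∈B , sep) =
    inj₂ (⁅ v ⁆ , (λ m → subst (_∈ B) (sym (x∈⁅y⁆⇒x≡y v m)) v∈B) ,
          (λ m m′ → trans (x∈⁅y⁆⇒x≡y v m) (sym (x∈⁅y⁆⇒x≡y v m′))) , sep)

  -- B meets the rest of G[A] only at the cut vertex, the element of C if there is one.
  Pendant : Subset n → Subset n → Subset n → Set
  Pendant A B C = B ⊆ A × AtMostOne C × (∃ λ v → v ∈ B × v ∉ C) ×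
    (∀ {a b} → a ∈ B → a ∉ C → b ∈ A → a ~ b → b ∈ B)

  -- Vertices of `X` are outside `C`, so their neighbours in `A` stay in `B`, and the separation
  -- keeps these in `X ∪ R`. Thus `R` replaces `C` as the place of attachment.
  Pendant-shrink : ∀ {A B C R X} → Pendant A B C → R ⊆ B → AtMostOne R → Separation (B ─ R) X →
    (∀ {x} → x ∈ X → x ∉ C) → Pendant A (X ∪ R) R × X ∪ R ⊂ B
  Pendant-shrink {A} {B} {C} {R} {X} (B⊆A , _ , _ , closedB) R⊆B oneR
    (X⊆ , (x , x∈X) , (y , y∈ , y∉X) , closed) X∩C =
    (B⊆A ∘ X∪R⊆B , oneR , (x , p⊆p∪q R x∈X , x∈p─q⇒x∉q B R (X⊆ x∈X)) , closed′) ,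
    X∪R⊆B , y , p─q⊆p B R y∈ , [ y∉X , x∈p─q⇒x∉q B R y∈ ]′ ∘ x∈p∪q⁻ X R
    where
    X∪R⊆B : X ∪ R ⊆ B
    X∪R⊆B = [ (λ m → p─q⊆p B R (X⊆ m)) , R⊆B ]′ ∘ x∈p∪q⁻ X R

    closed′ : ∀ {a b} → a ∈ X ∪ R → a ∉ R → b ∈ A → a ~ b → b ∈ X ∪ R
    closed′ {a} {b} a∈ a∉R b∈A a~b with x∈p∪q⁻ X R a∈ | b ∈? R
    ... | inj₂ a∈R | _ = contradiction a∈R a∉R
    ... | inj₁ a∈X | yes b∈R = q⊆p∪q X R b∈R
    ... | inj₁ a∈X | no b∉R = p⊆p∪q R (closed a∈X (x∈p∧x∉q⇒x∈p─q
      (closedB (p─q⊆p B R (X⊆ a∈X)) (X∩C a∈X) b∈A a~b) b∉R) a~b)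

  -- As `C` has at most one vertex, one side of any separation avoids it. Descending to that side
  -- ends at a set that plays the role of the end block.
  nonseparable-pendant : ∀ {A} B C → Acc _⊂_ B → Pendant A B C →
    ∃ λ B → ∃ λ C → Pendant A B C × NonSeparable G B
  nonseparable-pendant B C (acc rec) pend@(_ , oneC , (v , v∈B , _) , _)
    with nonseparable-or-separation B (v , v∈B)
  ... | inj₁ ns = B , C , pend , ns
  ... | inj₂ (R , R⊆B , oneR , X , sep) with any? (λ x → x ∈? X ×-dec x ∈? C)
  ...   | no ¬meet =
    let pend′ , smaller = Pendant-shrink pend R⊆B oneR sep (λ m m′ → ¬meet (_ , m , m′))
    in nonseparable-pendant _ R (rec smaller) pend′
  ...   | yes (x , x∈X , x∈C) =
    let pend′ , smaller = Pendant-shrink pend R⊆B oneR (Separation-sym sep)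
          (λ m m′ → x∈p─q⇒x∉q (B ─ R) X m (subst (_∈ X) (oneC x∈C m′) x∈X))
    in nonseparable-pendant _ R (rec smaller) pend′

  -- Suppose a pair in `B` is nonadjacent. A strictly larger nonseparable set would be a clique by
  -- induction and join the pair, so `B` is already a block, hence a clique.
  nonseparable⇒clique : BlockGraph G → ∀ B → Acc _⊃_ B → NonSeparable G B → IsClique G B
  nonseparable⇒clique blocks B (acc rec) ns u v u∈B v∈B u≢v =
    decidable-stable (u ~? v) λ u≁v → u≁v (blocks B (ns , maximal u≁v) u v u∈B v∈B u≢v)
    where
    maximal : ¬ (u ~ v) → ∀ C → NonSeparable G C → B ⊆ C → C ≡ B
    maximal u≁v C nsC B⊆C with ⊆-or-witness C B
    ... | inj₁ C⊆B = ⊆-antisym C⊆B B⊆C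
    ... | inj₂ w = contradiction
      (nonseparable⇒clique blocks C (rec ((λ {x} → B⊆C {x}) , w)) nsC u v (B⊆C u∈B) (B⊆C v∈B) u≢v) u≁v

  -- Three-vertex paths and 2-independence.

  P₃ : Subset n → Fin n → Fin n → Fin n → Set
  P₃ A a b c = a ∈ A × b ∈ A × c ∈ A × a ~ b × b ~ c × a ≢ c

  HasP₃ : Subset n → Set
  HasP₃ A = ∃ λ a → ∃ λ b → ∃ λ c → P₃ A a b c

  HasP₃? : Decidable HasP₃
  HasP₃? A = any? λ a → any? λ b → any? λ c →
    a ∈? A ×-dec b ∈? A ×-dec c ∈? A ×-dec a ~? b ×-dec b ~? c ×-dec ¬? (a ≟ c)

  -- The paths need not be induced, so triangles are excluded too: the minimal nonfaces are the
  -- connected sets of three vertices.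
  P₃-free : Subset n → Set
  P₃-free A = ¬ HasP₃ A

  P₃-free-down : ∀ {A B} → A ⊆ B → P₃-free B → P₃-free A
  P₃-free-down A⊆B free (a , b , c , a∈ , b∈ , c∈ , rest) =
    free (a , b , c , A⊆B a∈ , A⊆B b∈ , A⊆B c∈ , rest)

  2-independent⇒P₃-free : ∀ {A} → RIndependent G 2 A → P₃-free A
  2-independent⇒P₃-free {A} ind (a , b , c , a∈A , b∈A , c∈A , a~b , b~c , a≢c) =
    <-irrefl refl (≤-trans three (ind b b∈A S walks))
    where
    S : Subset n
    S = ⁅ a ⁆ ⊕ b ⊕ c

    three : 3 ≤ ∣ S ∣
    three = 3≤∣p∣ S (p⊆p⊕x {p = ⁅ a ⁆ ⊕ b} (p⊆p⊕x (x∈⁅x⁆ a)))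
      (p⊆p⊕x {p = ⁅ a ⁆ ⊕ b} x∈p⊕x) (x∈p⊕x {p = ⁅ a ⁆ ⊕ b}) (~⇒≢ a~b) (~⇒≢ b~c) a≢c

    walks : ∀ w → w ∈ S → Walk G A b w
    walks w m with x∈p⊕y⁻ m
    ... | inj₂ refl = step b∈A b~c (here c∈A)
    ... | inj₁ m′ with x∈p⊕y⁻ m′
    ...   | inj₂ refl = here b∈A
    ...   | inj₁ m″ with refl ← x∈⁅y⁆⇒x≡y a m″ = step b∈A (~-sym a~b) (here a∈A)

  Walk-end : ∀ {A u v} → Walk G A u v → v ∈ A
  Walk-end (here m) = m
  Walk-end (step _ _ p) = Walk-end p

  Walk-start : ∀ {A u v} → Walk G A u v → u ∈ A
  Walk-start (here m) = m
  Walk-start (step m _ _) = m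

  P₃-free-walk : ∀ {A u v} → P₃-free A → Walk G A u v → u ≡ v ⊎ u ~ v
  P₃-free-walk free (here _) = inj₁ refl
  P₃-free-walk {u = u} {v} free (step u∈A u~w walk) with P₃-free-walk free walk | u ≟ v
  ... | _         | yes refl = inj₁ refl
  ... | inj₁ refl | no _   = inj₂ u~w
  ... | inj₂ w~v  | no u≢v =
    contradiction (_ , _ , _ , u∈A , Walk-start walk , Walk-end walk , u~w , w~v , u≢v) free

  P₃-free⇒2-independent : ∀ {A} → P₃-free A → RIndependent G 2 A
  P₃-free⇒2-independent {A} free v v∈A S walks = ≤-trans (∣p∣≤1+∣p-x∣ S v) (s≤s rest)
    where
    member : ∀ {w} → w ∈ S - v → w ∈ A × v ~ w
    member {w} m with x∈p-y⁻ S v m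
    ... | w∈S , w≢v with P₃-free-walk free (walks w w∈S)
    ...   | inj₁ v≡w = contradiction (sym v≡w) w≢v
    ...   | inj₂ v~w = Walk-end (walks w w∈S) , v~w

    rest : ∣ S - v ∣ ≤ 1
    rest with nonempty? (S - v)
    ... | no empty = ≤-trans (p⊆q⇒∣p∣≤∣q∣ {q = Subset.⊥} (λ m → contradiction (_ , m) empty))
                             (≤-trans (≤-reflexive (∣⊥∣≡0 n)) z≤n)
    ... | yes (w , w∈) = ≤-trans (p⊆q⇒∣p∣≤∣q∣ unique) (≤-reflexive (∣⁅x⁆∣≡1 w))
      where
      unique : S - v ⊆ ⁅ w ⁆
      unique {x} x∈ with x ≟ w
      ... | yes refl = x∈⁅x⁆ w
      ... | no x≢w = let x∈A , v~x = member x∈ ; w∈A , v~w = member w∈ in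
        contradiction (x , v , w , x∈A , v∈A , w∈A , ~-sym v~x , v~w , x≢w) free

  P₃-free? : Decidable P₃-free
  P₃-free? A = ¬? (HasP₃? A)

  -- Criteria for a simplicial vertex.

  ¬P₃-free⇒HasP₃ : ∀ {A} → ¬ P₃-free A → HasP₃ A
  ¬P₃-free⇒HasP₃ {A} = decidable-stable (HasP₃? A)

  -- The two alternatives tell whether `v` is an end or the middle of the path.
  P₃-through : ∀ {T v} → P₃-free T → HasP₃ (T ⊕ v) → ∃ λ y → ∃ λ z →
    y ∈ T × z ∈ T × v ~ y × (y ~ z ⊎ v ~ z × y ≢ z)
  P₃-through free (a , b , c , a∈ , b∈ , c∈ , a~b , b~c , a≢c)
    with x∈p⊕y⁻ a∈ | x∈p⊕y⁻ b∈ | x∈p⊕y⁻ c∈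
  ... | inj₁ a∈T  | inj₁ b∈T  | inj₁ c∈T  = contradiction (a , b , c , a∈T , b∈T , c∈T , a~b , b~c , a≢c) free
  ... | inj₁ a∈T  | inj₁ b∈T  | inj₂ refl = b , a , b∈T , a∈T , ~-sym b~c , inj₁ (~-sym a~b)
  ... | inj₂ refl | inj₁ b∈T  | inj₁ c∈T  = b , c , b∈T , c∈T , a~b , inj₁ b~c
  ... | inj₂ refl | inj₁ b∈T  | inj₂ refl = contradiction refl a≢c
  ... | inj₁ a∈T  | inj₂ refl | inj₁ c∈T  = a , c , a∈T , c∈T , ~-sym a~b , inj₂ (b~c , a≢c)
  ... | inj₁ a∈T  | inj₂ refl | inj₂ refl = contradiction refl (~⇒≢ b~c)
  ... | inj₂ refl | inj₂ refl | _         = contradiction refl (~⇒≢ a~b)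

  -- `v` alone is already a nonface over `L`, so `S` is `L` and there is nothing to remove.
  loop-simplicial : ∀ {L U v} → v ∈ U → v ∉ L → ¬ P₃-free (L ⊕ v) → Simplicial P₃-free L U v
  loop-simplicial v∈U v∉L ¬free = v∈U , v∉L , λ T _ L⊆T _ _ _ →
    _ , (λ m → m) , L⊆T , ¬free , λ x x∈L x∉L → contradiction x∈L x∉L

  -- If `T ⊕ v` is not a face, `T` has an edge `y ~ z` with `v ~ y`, and `S` is `L` with this edge.
  -- A path surviving the removal of `y` or `z` gives another edge `y′ ~ z′` of `T` with `v ~ y′`.
  -- As `y′` equals or is adjacent to `y`, the two edges yield a path inside `T`.
  clique-nbhd-simplicial : ∀ {L U v} → v ∈ U → v ∉ L →
    (∀ {y z} → y ∈ U → z ∈ U → v ~ y → v ~ z → y ≢ z → y ~ z) → Simplicial P₃-free L U v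
  clique-nbhd-simplicial {L} {U} {v} v∈U v∉L clique = v∈U , v∉L , minimal
    where
    -- If `v` is the middle, the clique joins the two ends, so `v` can be taken as an end.
    normalise : ∀ {T} → T ⊆ U → P₃-free T → HasP₃ (T ⊕ v) →
      ∃ λ y → ∃ λ z → y ∈ T × z ∈ T × v ~ y × y ~ z
    normalise T⊆U free bad with P₃-through free bad
    ... | y , z , y∈T , z∈T , v~y , inj₁ y~z = y , z , y∈T , z∈T , v~y , y~z
    ... | y , z , y∈T , z∈T , v~y , inj₂ (v~z , y≢z) =
      y , z , y∈T , z∈T , v~y , clique (T⊆U y∈T) (T⊆U z∈T) v~y v~z y≢z

    minimal : ∀ T → P₃-free T → L ⊆ T → T ⊆ U → v ∉ T → ¬ P₃-free (T ⊕ v) →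
      ∃ λ S → L ⊆ S × S ⊆ T × ¬ P₃-free (S ⊕ v) × (∀ x → x ∈ S → x ∉ L → P₃-free ((T - x) ⊕ v))
    minimal T free L⊆T T⊆U v∉T ¬free with normalise T⊆U free (¬P₃-free⇒HasP₃ ¬free)
    ... | y , z , y∈T , z∈T , v~y , y~z =
      L ⊕ y ⊕ z , p⊆p⊕x ∘ p⊆p⊕x , ⊕-least (⊕-least L⊆T y∈T) z∈T ,
      (λ f → f (v , y , z , x∈p⊕x , p⊆p⊕x (p⊆p⊕x x∈p⊕x) , p⊆p⊕x x∈p⊕x , v~y , y~z , λ { refl → v∉T z∈T })) ,
      removal
      where
      removal : ∀ x → x ∈ L ⊕ y ⊕ z → x ∉ L → P₃-free ((T - x) ⊕ v)
      removal x x∈S x∉L bad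
        with normalise (T⊆U ∘ p─q⊆p T ⁅ x ⁆) (P₃-free-down (p─q⊆p T ⁅ x ⁆) free) bad
      ... | y′ , z′ , y′∈ , z′∈ , v~y′ , y′~z′
        with x∈p-y⁻ T x y′∈ | x∈p-y⁻ T x z′∈ | y′ ≟ y
      ... | y′∈T , y′≢x | z′∈T , z′≢x | yes refl = free (z , y , z′ , z∈T , y∈T , z′∈T , ~-sym y~z , y′~z′ , z≢z′)
        where
        z≢z′ : z ≢ z′
        z≢z′ refl with x∈p⊕y⁻ x∈S
        ... | inj₂ x≡z = z′≢x (sym x≡z)
        ... | inj₁ m with x∈p⊕y⁻ m
        ...   | inj₁ x∈L = x∉L x∈L
        ...   | inj₂ x≡y = y′≢x (sym x≡y)
      ... | y′∈T , y′≢x | z′∈T , z′≢x | no y′≢y with z ≟ y′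
      ...   | no z≢y′ = free (z , y , y′ , z∈T , y∈T , y′∈T , ~-sym y~z , y~y′ , z≢y′)
        where
        y~y′ : y ~ y′
        y~y′ = clique (T⊆U y∈T) (T⊆U y′∈T) v~y v~y′ (y′≢y ∘ sym)
      ...   | yes refl = free (y , z , z′ , y∈T , z∈T , z′∈T , y~z , y′~z′ , y≢z′)
        where
        y≢z′ : y ≢ z′
        y≢z′ refl with x∈p⊕y⁻ x∈S
        ... | inj₂ x≡z = y′≢x (sym x≡z)
        ... | inj₁ m with x∈p⊕y⁻ m
        ...   | inj₁ x∈L = x∉L x∈L
        ...   | inj₂ x≡y = z′≢x (sym x≡y)

  -- Since `l`, `v`, `y` form a path, `L ⊕ y` serves as `S` for a neighbour `y` of `v` in `T ─ L`.
  -- There is only one such `y`: two would be adjacent, and a neighbour in `L` of one of them would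
  -- complete a path in `T`.
  marked-nbhd-simplicial : ∀ {L U v l} → v ∈ U → v ∉ L → P₃-free (L ⊕ v) → l ∈ L → v ~ l →
    (∀ {y} → y ∈ U → y ∉ L → y ≢ v → l ~ y → v ~ y) →
    (∀ {y z} → y ∈ U → y ∉ L → z ∈ U → z ∉ L → v ~ y → v ~ z → y ≢ z →
      y ~ z × ∃ λ m → m ∈ L × (m ~ y ⊎ m ~ z)) →
    Simplicial P₃-free L U v
  marked-nbhd-simplicial {L} {U} {v} {l} v∈U v∉L freeL l∈L v~l common marked = v∈U , v∉L , minimal
    where
    only-l : ∀ {y} → y ∈ L → v ~ y → y ≡ l
    only-l {y} y∈L v~y = decidable-stable (y ≟ l) λ y≢l →
      freeL (y , v , l , p⊆p⊕x y∈L , x∈p⊕x , p⊆p⊕x l∈L , ~-sym v~y , v~l , y≢l)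

    l-isolated : ∀ {z} → z ∈ L → ¬ (l ~ z)
    l-isolated {z} z∈L l~z =
      freeL (v , l , z , x∈p⊕x , p⊆p⊕x l∈L , p⊆p⊕x z∈L , v~l , l~z , λ { refl → v∉L z∈L })

    -- If the neighbour found is in `L`, it is `l`. The third vertex of the path is then outside
    -- `L`, and it is adjacent to `v` directly or through `common`.
    normalise : ∀ {T} → T ⊆ U → v ∉ T → P₃-free T → HasP₃ (T ⊕ v) → ∃ λ y → y ∈ T × y ∉ L × v ~ y
    normalise T⊆U v∉T free bad with P₃-through free bad
    ... | y , z , y∈T , z∈T , v~y , e with y ∈? L
    ...   | no y∉L = y , y∈T , y∉L , v~y
    ...   | yes y∈L with refl ← only-l y∈L v~y | e
    ...     | inj₁ l~z = z , z∈T , (λ z∈L → l-isolated z∈L l~z) ,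
      common (T⊆U z∈T) (λ z∈L → l-isolated z∈L l~z) (λ { refl → v∉T z∈T }) l~z
    ...     | inj₂ (v~z , l≢z) = z , z∈T , (λ z∈L → l≢z (sym (only-l z∈L v~z))) , v~z

    minimal : ∀ T → P₃-free T → L ⊆ T → T ⊆ U → v ∉ T → ¬ P₃-free (T ⊕ v) →
      ∃ λ S → L ⊆ S × S ⊆ T × ¬ P₃-free (S ⊕ v) × (∀ x → x ∈ S → x ∉ L → P₃-free ((T - x) ⊕ v))
    minimal T free L⊆T T⊆U v∉T ¬free with normalise T⊆U v∉T free (¬P₃-free⇒HasP₃ ¬free)
    ... | y , y∈T , y∉L , v~y =
      L ⊕ y , p⊆p⊕x , ⊕-least L⊆T y∈T ,
      (λ f → f (l , v , y , p⊆p⊕x (p⊆p⊕x l∈L) , x∈p⊕x , p⊆p⊕x x∈p⊕x , ~-sym v~l , v~y , λ { refl → y∉L l∈L })) ,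
      removal
      where
      removal : ∀ x → x ∈ L ⊕ y → x ∉ L → P₃-free ((T - x) ⊕ v)
      removal x x∈S x∉L bad with x∈p⊕y⁻ x∈S
      ... | inj₁ x∈L = x∉L x∈L
      ... | inj₂ refl
        with normalise (T⊆U ∘ p─q⊆p T ⁅ x ⁆) (v∉T ∘ p─q⊆p T ⁅ x ⁆) (P₃-free-down (p─q⊆p T ⁅ x ⁆) free) bad
      ... | z , z∈ , z∉L , v~z with x∈p-y⁻ T x z∈
      ... | z∈T , z≢y with marked (T⊆U y∈T) y∉L (T⊆U z∈T) z∉L v~y v~z (z≢y ∘ sym)
      ... | y~z , m , m∈L , inj₁ m~y =
        free (m , y , z , L⊆T m∈L , y∈T , z∈T , m~y , y~z , λ { refl → z∉L m∈L })
      ... | y~z , m , m∈L , inj₂ m~z =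
        free (m , z , y , L⊆T m∈L , z∈T , y∈T , m~z , ~-sym y~z , λ { refl → y∉L m∈L })

  -- Simplicial vertices from block graphs.

  module _ {L U : Subset n} where

    -- Only the loose vertices of L enter the graph whose end block is taken, so that no
    -- end block has a noncut vertex in L.
    Loose : Fin n → Set
    Loose c = ∃ λ y → ∃ λ z → (y ∈ U × y ∉ L) × (z ∈ U × z ∉ L) × c ~ y × c ~ z × y ≢ z × ¬ (y ~ z)

    Core : Fin n → Set
    Core x = x ∈ U × (x ∉ L ⊎ Loose x)

    Core? : Decidable Core
    Core? x = x ∈? U ×-dec (¬? (x ∈? L) ⊎-dec any? λ y → any? λ z →
      (y ∈? U ×-dec ¬? (y ∈? L)) ×-dec (z ∈? U ×-dec ¬? (z ∈? L)) ×-dec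
      x ~? y ×-dec x ~? z ×-dec ¬? (y ≟ z) ×-dec ¬? (y ~? z))

    ∉L⇒core : ∀ {x} → x ∈ U → x ∉ L → x ∈ ⟪ Core? ⟫
    ∉L⇒core x∈U x∉L = ∈⟪⟫⁺ Core? (x∈U , inj₁ x∉L)

    noncore⇒∈L : ∀ {x} → x ∈ U → x ∉ ⟪ Core? ⟫ → x ∈ L
    noncore⇒∈L {x} x∈U x∉core = decidable-stable (x ∈? L) (x∉core ∘ ∉L⇒core x∈U)

    exists-simplicial : BlockGraph G → L ⊆ U → (∃ λ x → x ∈ U × x ∉ L) → ∃ (Simplicial P₃-free L U)
    exists-simplicial blocks L⊆U (x₀ , x₀∈U , x₀∉L)
      with any? (λ v → v ∈? U ×-dec ¬? (v ∈? L) ×-dec HasP₃? (L ⊕ v))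
    ... | yes (v , v∈U , v∉L , bad) = v , loop-simplicial v∈U v∉L (λ free → free bad)
    ... | no ¬loop
      -- The descent starts at the whole core, attached to nothing, so `C` is empty.
      with nonseparable-pendant ⟪ Core? ⟫ Subset.⊥ (⊂-wellFounded _)
             ((λ m → m) , (λ m → contradiction m ∉⊥) , (x₀ , ∉L⇒core x₀∈U x₀∉L , ∉⊥) , λ _ _ b∈ _ → b∈)
    ... | B , C , (B⊆ , oneC , (v₀ , v₀∈B , v₀∉C) , closed) , ns =
      choose (any? λ v → v ∈? B ×-dec ¬? (v ∈? C) ×-dec ¬? (marked? v))
      where
      Marked : Fin n → Set
      Marked v = ∃ λ l → l ∈ L × l ∉ ⟪ Core? ⟫ × v ~ l

      marked? : Decidable Marked
      marked? v = any? λ l → l ∈? L ×-dec ¬? (l ∈? ⟪ Core? ⟫) ×-dec v ~? l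

      cliqueB : IsClique G B
      cliqueB = nonseparable⇒clique blocks B (⊃-wellFounded B) ns

      B⊆U : B ⊆ U
      B⊆U = proj₁ ∘ ∈⟪⟫⁻ Core? ∘ B⊆

      -- A core vertex in `L` is loose. Outside `C`, its two nonadjacent neighbours would both lie
      -- in the clique `B`.
      inner∉L : ∀ {x} → x ∈ B → x ∉ C → x ∉ L
      inner∉L x∈B x∉C x∈L with ∈⟪⟫⁻ Core? (B⊆ x∈B)
      ... | _ , inj₁ x∉L = x∉L x∈L
      ... | _ , inj₂ (y , z , (y∈U , y∉L) , (z∈U , z∉L) , x~y , x~z , y≢z , y≁z) =
        y≁z (cliqueB y z (closed x∈B x∉C (∉L⇒core y∈U y∉L) x~y) (closed x∈B x∉C (∉L⇒core z∈U z∉L) x~z) y≢z)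

      choose : Dec (∃ λ v → v ∈ B × v ∉ C × ¬ Marked v) → ∃ (Simplicial P₃-free L U)
      choose (yes (v , v∈B , v∉C , unmarked)) =
        v , clique-nbhd-simplicial (B⊆U v∈B) (inner∉L v∈B v∉C) λ y∈U z∈U v~y v~z →
          cliqueB _ _ (nbr y∈U v~y) (nbr z∈U v~z)
        where
        nbr : ∀ {y} → y ∈ U → v ~ y → y ∈ B
        nbr {y} y∈U v~y = closed v∈B v∉C (decidable-stable (y ∈? ⟪ Core? ⟫) λ y∉core →
          unmarked (y , noncore⇒∈L y∈U y∉core , y∉core , v~y)) v~y
      choose (no none-unmarked) =
        let l , l∈L , l∉core , v~l = marked v₀∈B v₀∉C in
        v₀ , marked-nbhd-simplicial v₀∈U v₀∉L (λ bad → ¬loop (v₀ , v₀∈U , v₀∉L , bad)) l∈L v~l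
          -- `l` is outside the core, hence not loose: `v₀` and `y`, both neighbours of `l` outside
          -- `L`, must be adjacent.
          (λ {y} y∈U y∉L y≢v l~y → decidable-stable (v₀ ~? y) λ v≁y → l∉core
            (∈⟪⟫⁺ Core? (L⊆U l∈L , inj₂ (v₀ , y , (v₀∈U , v₀∉L) , (y∈U , y∉L) , ~-sym v~l , l~y , y≢v ∘ sym , v≁y))))
          λ y∈U y∉L z∈U z∉L v~y v~z y≢z →
            let y∈B = closed v₀∈B v₀∉C (∉L⇒core y∈U y∉L) v~y
                z∈B = closed v₀∈B v₀∉C (∉L⇒core z∈U z∉L) v~z
            in cliqueB _ _ y∈B z∈B y≢z , one-marked y∈B z∈B y≢z
        where
        v₀∈U : v₀ ∈ U
        v₀∈U = B⊆U v₀∈B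

        v₀∉L : v₀ ∉ L
        v₀∉L = inner∉L v₀∈B v₀∉C

        marked : ∀ {x} → x ∈ B → x ∉ C → Marked x
        marked {x} x∈B x∉C = decidable-stable (marked? x) λ ¬m → none-unmarked (x , x∈B , x∉C , ¬m)

        -- At most one of the two vertices is in `C`; the other is marked.
        one-marked : ∀ {y z} → y ∈ B → z ∈ B → y ≢ z → ∃ λ m → m ∈ L × (m ~ y ⊎ m ~ z)
        one-marked {y} {z} y∈B z∈B y≢z with y ∈? C | z ∈? C
        ... | no y∉C | _ = let m , m∈L , _ , y~m = marked y∈B y∉C in m , m∈L , inj₁ (~-sym y~m)
        ... | yes _ | no z∉C = let m , m∈L , _ , z~m = marked z∈B z∉C in m , m∈L , inj₂ (~-sym z~m)
        ... | yes y∈C | yes z∈C = contradiction (oneC y∈C z∈C) y≢z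

  -- The full complex as the minor between `⊥` and `⊤`.

  Facet⇒IsFacet : ∀ {X} → Facet P₃-free Subset.⊥ Subset.⊤ X →
    IsFacet (Ind G 2) X
  Facet⇒IsFacet {X} (free , _ , _ , max) = P₃-free⇒2-independent free , maximal
    where
    maximal : ∀ Y → Ind G 2 Y → X ⊆ Y → Y ≡ X
    maximal Y indY X⊆Y = ⊆-antisym
      (λ {y} y∈Y → decidable-stable (y ∈? X) λ y∉X →
        max ∈⊤ y∉X (P₃-free-down (⊕-least X⊆Y y∈Y) (2-independent⇒P₃-free indY))) X⊆Y

  IsFacet⇒Facet : ∀ {X} → IsFacet (Ind G 2) X →
    Facet P₃-free Subset.⊥ Subset.⊤ X
  IsFacet⇒Facet {X} (ind , max) = 2-independent⇒P₃-free ind , ⊥⊆ , ⊆⊤ , λ {x} _ x∉X free →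
    x∉X (subst (x ∈_) (max (X ⊕ x) (P₃-free⇒2-independent free) p⊆p⊕x) x∈p⊕x)

theorem4p7 : ∀ (n : ℕ) (G : Graph n) → BlockGraph G → Shellable (Ind G 2)
theorem4p7 n G blocks =
  let Xs , sh , sound , complete = shelled (P₃-free? G) (P₃-free-down G)
        (λ _ L⊆U → exists-simplicial G blocks L⊆U) Subset.⊥ Subset.⊤ ⊥⊆ (⊂-wellFounded _)
  in shelled⇒shellable (Ind G 2)
       (λ X⊆Y ind → P₃-free⇒2-independent G (P₃-free-down G X⊆Y (2-independent⇒P₃-free G ind)))
       (Xs , sh , Facet⇒IsFacet G ∘ sound , complete ∘ IsFacet⇒Facet G)
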